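{- There is an absolute constant $C$ such that, for all sufficiently large $n$, there is a connected graph $G$ on $n$ vertices with $$\operatorname{psd}(G)\ge n-C\sqrt n.$$ Consequently, $$\lim_{n\to\infty}\frac{\operatorname{PS}(n)}{n}=1.$$
   Context: All graphs are finite and simple. For a graph $G$ and vertices $u,v\in V(G)$: $u,v$ are similar if some automorphism of $G$ maps $u$ to $v$; they are removal-similar if $G-u\cong G-v$; they are pseudosimilar if they are removal-similar but not similar. A pseudosimilar mate of $v$ in $G$ is a vertex $u$ of $G$ such that $u,v$ are pseudosimilar in $G$. An active pseudosimilarity chain of length $k$ in $G$ is a sequence of distinct vertices $v_1,\ldots,v_k$ of $G$ such that, for each $j=0,\ldots,k-1$, writing $G_j=G-\{v_1,\ldots,v_j\}$ (so $G_0=G$), the vertex $v_{j+1}$ has a pseudosimilar mate in $G_j$. The pseudosimilarity depth $\operatorname{psd}(G)$ is the maximum $k$ such that $G$ has an active pseudosimilarity chain of length $k$ (the empty chain has length $0$). For $n\ge 1$, $\operatorname{PS}(n)=\max\{\operatorname{psd}(G): |V(G)|=n\}$. -}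

module Defs where

open import Data.Bool using (Bool; true; false; T)
import Data.Bool.Properties as Bool
open import Data.Empty using (⊥-elim; ⊥-elim-irr)
open import Data.Fin using (Fin; zero; suc) renaming (_<_ to _<ᶠ_)
import Data.Fin.Properties as Fin
open import Data.Irrelevant using ([_])
open import Data.List using (List; []; _∷_; length; allFin)
import Data.List as List
open import Data.List.Membership.Propositional using () renaming (_∈_ to _∈ˡ_)
open import Data.List.Membership.Propositional.Properties using (∈-allFin)
open import Data.List.Relation.Unary.Any using (here; there; index)
import Data.List.Relation.Unary.Any as Any
import Data.List.Relation.Unary.All as All
open import Data.List.Relation.Unary.Any.Properties using (lookup-index)
open import Data.Nat using (ℕ; zero; suc; _≤_; _∸_; _*_; _^_)
import Data.Nat.Properties as ℕ
open import Data.Product using (∃; _×_; _,_; proj₁; proj₂)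
open import Data.Refinement
  using (Refinement-syntax; value; value-injective) renaming (_,_ to _,ᵣ_; _≟_ to ≟ᵣ)
open import Data.Vec using (Vec; []; _∷_; lookup; tabulate)
open import Data.Vec.Properties using (lookup∘tabulate)
open import Data.Vec.Relation.Unary.AllPairs using ([]; allPairs?)
open import Data.Vec.Relation.Unary.Unique.Propositional using (Unique)
open import Data.Vec.Relation.Unary.Unique.Propositional.Properties using (lookup-injective)
open import Function using (_∘_)
open import Function.Bundles using (_↔_; mk↔ₛ′; module Inverse)
open import Relation.Binary.Construct.Closure.ReflexiveTransitive using (Star)
open import Relation.Binary.Definitions using (DecidableEquality)
open import Relation.Binary.PropositionalEquality
  using (_≡_; _≗_; refl; sym; trans; cong; cong₂; subst)
open import Relation.Nullary using (¬_; Dec; yes; no; ¬?)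
open import Relation.Nullary.Decidable using (map′; _×-dec_)
open import Relation.Unary using (Pred; Decidable; _∉_; ｛_｝)
open import Level using (0ℓ)

private variable
  V W : Set
  k n : ℕ

-- A simple graph with vertex set V.  A Bool-valued adjacency loses nothing for
-- the finite graphs considered here and keeps everything decidable.
record Graph (V : Set) : Set where
  field
    adj        : V → V → Bool
    adj-sym    : ∀ x y → adj x y ≡ adj y x
    adj-irrefl : ∀ x → adj x x ≡ false

open Graph public

Connected : Graph V → Set
Connected {V} G = (x y : V) → Star (λ a b → T (adj G a b)) x y

record _≅_ (G : Graph V) (H : Graph W) : Set where
  field
    bijection    : V ↔ W
    adj-preserve : ∀ x y →
      adj G x y ≡ adj H (Inverse.to bijection x) (Inverse.to bijection y)

open _≅_ public

infix 4 _≅_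

-- Vertex deletion G − S.  Non-membership is stored irrelevantly, so two vertices of
-- G ∖ S are equal as soon as the underlying vertices of G are.
_∖_ : Graph V → (S : Pred V 0ℓ) → Graph [ x ∈ V ∣ x ∉ S ]
G ∖ S = record
  { adj        = λ x y → adj G (value x) (value y)
  ; adj-sym    = λ x y → adj-sym G (value x) (value y)
  ; adj-irrefl = λ x → adj-irrefl G (value x)
  }

infixl 6 _∖_

Similar : Graph V → V → V → Set
Similar G u v = ∃ λ (φ : G ≅ G) → Inverse.to (bijection φ) u ≡ v

RemovalSimilar : Graph V → V → V → Set
RemovalSimilar G u v = G ∖ ｛ u ｝ ≅ G ∖ ｛ v ｝

Pseudosimilar : Graph V → V → V → Set
Pseudosimilar G u v = RemovalSimilar G u v × ¬ Similar G u v

HasMate : Graph V → V → Set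
HasMate G v = ∃ λ u → Pseudosimilar G u v

-- With 0-based indices, Before vs j is the set {v₁ , … , vⱼ} and
-- lookup vs j is the vertex vⱼ₊₁.
Before : Vec V k → Fin k → Pred V 0ℓ
Before vs j x = ∃ λ i → i <ᶠ j × lookup vs i ≡ x

lookup∉Before : {vs : Vec V k} → Unique vs → ∀ j → lookup vs j ∉ Before vs j
lookup∉Before distinct j (i , i<j , eq) =
  Fin.<-irrefl (lookup-injective distinct i j eq) i<j

record ActiveChain (G : Graph V) (k : ℕ) : Set where
  field
    vertices : Vec V k
    distinct : Unique vertices
    active   : ∀ j → HasMate (G ∖ Before vertices j)
                             (lookup vertices j ,ᵣ [ lookup∉Before distinct j ])

open ActiveChain public

IsMaximum : (ℕ → Set) → ℕ → Set
IsMaximum P m = P m × (∀ k → P k → k ≤ m)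

IsMaximum-unique : ∀ {P Q : ℕ → Set} {a b} → (∀ k → P k → Q k) → (∀ k → Q k → P k) →
                   IsMaximum P a → IsMaximum Q b → a ≡ b
IsMaximum-unique P⇒Q Q⇒P (pa , ≤a) (qb , ≤b) =
  ℕ.≤-antisym (≤b _ (P⇒Q _ pa)) (≤a _ (Q⇒P _ qb))

maximum : ∀ {P : ℕ → Set} → Decidable P → ∀ b → (∀ k → P k → k ≤ b) → ∃ P →
          ∃ (IsMaximum P)
maximum P? b bound inhabited with P? b
... | yes p = b , p , bound
maximum {P} P? zero bound (k , p) | no ¬p =
  ⊥-elim (¬p (subst P (ℕ.n≤0⇒n≡0 (bound k p)) p))
maximum {P} P? (suc b) bound inhabited | no ¬p =
  maximum P? b
    (λ k p → ℕ.≤-pred (ℕ.≤∧≢⇒< (bound k p) (λ eq → ¬p (subst P eq p))))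
    inhabited

-- The two maxima psd and PS are extracted from a decision procedure: the existence of
-- chains, mates and isomorphisms over finite vertex sets is decided by exhaustive search.

record Finite (A : Set) : Set where
  field
    elements : List A
    complete : ∀ a → a ∈ˡ elements
    _≟_      : DecidableEquality A

open Finite

private variable
  A B : Set

finite-Fin : ∀ n → Finite (Fin n)
finite-Fin n = record { elements = allFin n ; complete = ∈-allFin ; _≟_ = Fin._≟_ }

finite-Bool : Finite Bool
finite-Bool = record
  { elements = true ∷ false ∷ []
  ; complete = λ { true → here refl ; false → there (here refl) }
  ; _≟_      = Bool._≟_
  }

finite-Refinement : {S : Pred A 0ℓ} → Finite A → Decidable S → Finite [ x ∈ A ∣ x ∉ S ]
finite-Refinement {A} {S} fin S? = record
  { elements = filtered (elements fin)
  ; complete = λ x → filtered⁺ x (complete fin (value x))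
  ; _≟_      = ≟ᵣ (_≟_ fin)
  }
  where
  filtered : List A → List [ x ∈ A ∣ x ∉ S ]
  filtered [] = []
  filtered (x ∷ xs) with S? x
  ... | yes _  = filtered xs
  ... | no x∉S = (x ,ᵣ [ x∉S ]) ∷ filtered xs

  filtered⁺ : ∀ x {xs} → value x ∈ˡ xs → x ∈ˡ filtered xs
  filtered⁺ (x ,ᵣ [ x∉S ]) {y ∷ _} (here refl) with S? y
  ... | yes y∈S = ⊥-elim-irr (x∉S y∈S)
  ... | no _    = here refl
  filtered⁺ x {y ∷ _} (there x∈xs) with S? y
  ... | yes _ = filtered⁺ x x∈xs
  ... | no _  = there (filtered⁺ x x∈xs)

∃? : Finite A → {P : A → Set} → Decidable P → Dec (∃ P)
∃? fin P? = map′ Any.satisfied (λ (a , p) → Any.map (λ { refl → p }) (complete fin a))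
                 (Any.any? P? (elements fin))

∀? : Finite A → {P : A → Set} → Decidable P → Dec (∀ a → P a)
∀? fin P? = map′ (λ ps a → All.lookup ps (complete fin a)) (λ p → All.tabulate λ {a} _ → p a)
                 (All.all? P? (elements fin))

∃Vec? : Finite A → ∀ k → {P : Vec A k → Set} → Decidable P → Dec (∃ P)
∃Vec? fin zero P? = map′ (λ p → [] , p) (λ { ([] , p) → p }) (P? [])
∃Vec? fin (suc k) P? =
  map′ (λ (x , xs , p) → x ∷ xs , p) (λ { (x ∷ xs , p) → x , xs , p })
       (∃? fin λ x → ∃Vec? fin k λ xs → P? (x ∷ xs))

∃Fun? : Finite A → Finite B → {P : (A → B) → Set} →
        (∀ {f g} → f ≗ g → P f → P g) → Decidable P → Dec (∃ P)
∃Fun? {A} {B} finA finB {P} resp P? =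
  map′ (λ (t , p) → fromTable t , p) (λ (f , p) → toTable f , resp (fromTable∘toTable f) p)
       (∃Vec? finB (length (elements finA)) (P? ∘ fromTable))
  where
  fromTable : Vec B (length (elements finA)) → A → B
  fromTable t a = lookup t (index (complete finA a))

  toTable : (A → B) → Vec B (length (elements finA))
  toTable f = tabulate (f ∘ List.lookup (elements finA))

  fromTable∘toTable : ∀ f → f ≗ fromTable (toTable f)
  fromTable∘toTable f a =
    trans (cong f (lookup-index (complete finA a)))
          (sym (lookup∘tabulate _ (index (complete finA a))))

∃≅? : Finite V → Finite W → (G : Graph V) (H : Graph W) →
      {P : (V → W) → Set} → (∀ {f g} → f ≗ g → P f → P g) → Decidable P →
      Dec (∃ λ (φ : G ≅ H) → P (Inverse.to (bijection φ)))
∃≅? {V} {W} finV finW G H {P} resp P? =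
  map′ (λ (f , (g , fg , gf) , pres , p) →
          record { bijection = mk↔ₛ′ f g fg gf ; adj-preserve = pres } , p)
       (λ (φ , p) → let module φ = Inverse (bijection φ) in
          φ.to , (φ.from , φ.strictlyInverseˡ , φ.strictlyInverseʳ) , adj-preserve φ , p)
       (∃Fun? finV finW respQ Q?)
  where
  Inv : (V → W) → (W → V) → Set
  Inv f g = (∀ y → f (g y) ≡ y) × (∀ x → g (f x) ≡ x)

  Q : (V → W) → Set
  Q f = ∃ (Inv f) × (∀ x y → adj G x y ≡ adj H (f x) (f y)) × P f

  respQ : ∀ {f g} → f ≗ g → Q f → Q g
  respQ f≗g ((h , fh , hf) , pres , p) =
    (h , (λ y → trans (sym (f≗g (h y))) (fh y)) , (λ x → trans (cong h (sym (f≗g x))) (hf x))) ,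
    (λ x y → trans (pres x y) (cong₂ (adj H) (f≗g x) (f≗g y))) ,
    resp f≗g p

  Q? : Decidable Q
  Q? f =
    ∃Fun? finW finV
      (λ g≗h (fg , gf) → (λ y → trans (cong f (sym (g≗h y))) (fg y)) ,
                         (λ x → trans (sym (g≗h (f x))) (gf x)))
      (λ g → ∀? finW (λ y → _≟_ finW (f (g y)) y) ×-dec ∀? finV (λ x → _≟_ finV (g (f x)) x))
    ×-dec
    ∀? finV (λ x → ∀? finV λ y → adj G x y Bool.≟ adj H (f x) (f y))
    ×-dec
    P? f

hasMate? : Finite V → (G : Graph V) → Decidable (HasMate G)
hasMate? fin G v = ∃? fin λ u → removalSimilar? u ×-dec ¬? (similar? u)
  where
  open import Data.Unit using (⊤; tt)

  removalSimilar? : ∀ u → Dec (RemovalSimilar G u v)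
  removalSimilar? u =
    map′ proj₁ (_, tt)
      (∃≅? (finite-Refinement fin (_≟_ fin u)) (finite-Refinement fin (_≟_ fin v))
           (G ∖ ｛ u ｝) (G ∖ ｛ v ｝) {P = λ _ → ⊤} (λ _ _ → tt) (λ _ → yes tt))

  similar? : ∀ u → Dec (Similar G u v)
  similar? u = ∃≅? fin fin G G {P = λ f → f u ≡ v}
                 (λ f≗g fu≡v → trans (sym (f≗g u)) fu≡v) (λ f → _≟_ fin (f u) v)

activeChain? : Finite V → (G : Graph V) → Decidable (ActiveChain G)
activeChain? fin G k =
  map′ (λ (vs , u , a) → record { vertices = vs ; distinct = u ; active = a })
       (λ c → vertices c , distinct c , active c)
       (∃Vec? fin k search)
  where
  Good : Vec _ k → Set
  Good vs = ∃ λ (u : Unique vs) →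
    ∀ j → HasMate (G ∖ Before vs j) (lookup vs j ,ᵣ [ lookup∉Before u j ])

  search : Decidable Good
  search vs with allPairs? (λ x y → ¬? (_≟_ fin x y)) vs
  ... | no ¬u = no (¬u ∘ proj₁)
  -- The proof of distinctness only occurs irrelevantly in the condition on mates.
  ... | yes u = map′ (u ,_) proj₂
    (∀? (finite-Fin k) λ j →
      hasMate? (finite-Refinement fin λ x → ∃? (finite-Fin k) λ i →
                  (i Fin.<? j) ×-dec (_≟_ fin (lookup vs i) x))
               (G ∖ Before vs j) _)

emptyChain : (G : Graph V) → ActiveChain G 0
emptyChain G = record { vertices = [] ; distinct = [] ; active = λ () }

chain-length≤ : {G : Graph (Fin n)} → ActiveChain G k → k ≤ n
chain-length≤ c = Fin.injective⇒≤ (lookup-injective (distinct c) _ _)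

abstract
  psd-exists : (G : Graph (Fin n)) → ∃ (IsMaximum (ActiveChain G))
  psd-exists {n} G =
    maximum (activeChain? (finite-Fin n) G) n (λ _ → chain-length≤) (0 , emptyChain G)

psd : Graph (Fin n) → ℕ
psd G = proj₁ (psd-exists G)

psd-isMaximum : (G : Graph (Fin n)) → IsMaximum (ActiveChain G) (psd G)
psd-isMaximum G = proj₂ (psd-exists G)

AdjEq : Graph V → Graph V → Set
AdjEq G H = ∀ x y → adj G x y ≡ adj H x y

AdjEq-sym : {G H : Graph V} → AdjEq G H → AdjEq H G
AdjEq-sym e x y = sym (e x y)

≅-cong : {G G′ : Graph V} {H H′ : Graph W} → AdjEq G G′ → AdjEq H H′ → G ≅ H → G′ ≅ H′
≅-cong e e′ φ = record
  { bijection    = bijection φ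
  ; adj-preserve = λ x y → trans (sym (e x y)) (trans (adj-preserve φ x y) (e′ _ _))
  }

hasMate-cong : {G H : Graph V} → AdjEq G H → ∀ {v} → HasMate G v → HasMate H v
hasMate-cong {G = G} {H} e (u , φ , ¬sim) =
  u , ≅-cong {G = G ∖ _} {H ∖ _} {G ∖ _} {H ∖ _} (λ _ _ → e _ _) (λ _ _ → e _ _) φ ,
  λ (ψ , eq) → ¬sim (≅-cong (AdjEq-sym {G = G} {H} e) (AdjEq-sym {G = G} {H} e) ψ , eq)

activeChain-cong : {G H : Graph V} → AdjEq G H → ∀ k → ActiveChain G k → ActiveChain H k
activeChain-cong {G = G} {H} e k c = record
  { vertices = vertices c
  ; distinct = distinct c
  ; active   = λ j → hasMate-cong {G = G ∖ _} {H ∖ _} (λ _ _ → e _ _) (active c j)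
  }

psd-cong : {G H : Graph (Fin n)} → AdjEq G H → psd G ≡ psd H
psd-cong {G = G} {H} e =
  IsMaximum-unique (activeChain-cong e) (activeChain-cong (AdjEq-sym {G = G} {H} e))
                   (psd-isMaximum G) (psd-isMaximum H)

∃Graph? : ∀ n {P : Graph (Fin n) → Set} → (∀ {G H} → AdjEq G H → P G → P H) →
          Decidable P → Dec (∃ P)
∃Graph? n {P} resp P? =
  map′ (λ (M , s , p) → toGraph M s , p)
       (λ (G , p) →
          matrix G , simple G ,
          resp {G} {toGraph (matrix G) (simple G)} (λ i j → sym (entry G i j)) p)
       (∃Rows? n Good?)
  where
  Matrix = Vec (Vec Bool n) n

  at : Matrix → Fin n → Fin n → Bool
  at M i j = lookup (lookup M i) j

  matrix : Graph (Fin n) → Matrix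
  matrix G = tabulate λ i → tabulate (adj G i)

  entry : ∀ G i j → at (matrix G) i j ≡ adj G i j
  entry G i j = trans (cong (λ r → lookup r j) (lookup∘tabulate _ i)) (lookup∘tabulate _ j)

  Simple : Matrix → Set
  Simple M = (∀ i j → at M i j ≡ at M j i) × (∀ i → at M i i ≡ false)

  toGraph : ∀ M → Simple M → Graph (Fin n)
  toGraph M (s , i) = record { adj = at M ; adj-sym = s ; adj-irrefl = i }

  simple : ∀ G → Simple (matrix G)
  simple G =
    (λ i j → trans (entry G i j) (trans (adj-sym G i j) (sym (entry G j i)))) ,
    (λ i → trans (entry G i i) (adj-irrefl G i))

  Good : Matrix → Set
  Good M = ∃ λ (s : Simple M) → P (toGraph M s)

  Good? : Decidable Good
  Good? M with ∀? (finite-Fin n) (λ i → ∀? (finite-Fin n) λ j → at M i j Bool.≟ at M j i)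
               ×-dec ∀? (finite-Fin n) (λ i → at M i i Bool.≟ false)
  ... | no ¬s = no (¬s ∘ proj₁)
  ... | yes s = map′ (s ,_) (λ (_ , p) → resp (λ _ _ → refl) p) (P? (toGraph M s))

  ∃Rows? : ∀ m {Q : Vec (Vec Bool n) m → Set} → Decidable Q → Dec (∃ Q)
  ∃Rows? zero Q? = map′ (λ q → [] , q) (λ { ([] , q) → q }) (Q? [])
  ∃Rows? (suc m) Q? =
    map′ (λ (r , M , q) → r ∷ M , q) (λ { (r ∷ M , q) → r , M , q })
         (∃Vec? finite-Bool n λ r → ∃Rows? m λ M → Q? (r ∷ M))

edgeless : Graph V
edgeless = record
  { adj = λ _ _ → false ; adj-sym = λ _ _ → refl ; adj-irrefl = λ _ → refl }

PsdValue : ℕ → ℕ → Set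
PsdValue n k = ∃ λ (G : Graph (Fin n)) → psd G ≡ k

abstract
  PS-exists : ∀ n → ∃ (IsMaximum (PsdValue n))
  PS-exists n = maximum
    (λ k → ∃Graph? n (λ {G} {H} e eq → trans (sym (psd-cong {G = G} {H} e)) eq)
                     (λ G → psd G ℕ.≟ k))
    n
    (λ { _ (G , refl) → chain-length≤ (proj₁ (psd-isMaximum G)) })
    (_ , edgeless , refl)

PS : ℕ → ℕ
PS n = proj₁ (PS-exists n)

PS-isMaximum : ∀ n → IsMaximum (PsdValue n) (PS n)
PS-isMaximum n = proj₂ (PS-exists n)

-- k ≥ n − C √m, rearranged to n − k ≤ C √m and squared.  Truncating n − k at 0 is
-- harmless because the right-hand side is non-negative.
_≥_-_√_ : (k n C m : ℕ) → Set
k ≥ n - C √ m = (n ∸ k) ^ 2 ≤ C ^ 2 * m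

infix 4 _≥_-_√_

{-# OPTIONS --safe #-}
module Submission where

-- Let a, b ≥ 2 be coprime.  Take two disjoint cyclic orders, of lengths a and b, and let
-- p t and q t be the positions of the integer t modulo a and modulo b.  Every position i
-- carries a hub and a spur: the hubs form a clique and each spur is joined to the hub at
-- its position.  Bead t is joined to the hubs at p t and q t and to the spurs at
-- p (t + 1) and q (t + 1).  Let Γ k be the graph with beads 0, …, k − 1.
--
-- Rotating both cycles by one step carries bead t to bead t + 1.  Hence Γ k minus its
-- first bead and Γ k minus its last bead are both copies of Γ (k − 1), and the two end
-- beads are removal-similar.  They are not similar if 2 ≤ k < a b.  An automorphism
-- taking the first bead to the last must carry the hubs at p 0, q 0 to those at
-- p (k − 1), q (k − 1), because among the neighbours of a bead only its two hubs are
-- adjacent; so it carries the spurs at p 1, q 1 to those at p k, q k, next the hubs at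
-- p 1, q 1 to those at p k, q k, and bead 1 to a vertex adjacent to the last two.  That
-- vertex has to be a bead whose number is congruent to k modulo a and modulo b, hence
-- bead k by the Chinese remainder theorem, and there is no such bead (impossible).
-- The spurs orient the cycles: they exclude the reflection t ↦ k − 1 − t.
--
-- So the last bead always has a mate, and deleting the beads from the last one on is an
-- active chain that ends when one bead remains.  With b = a + 1 the graph has
-- 2 (2 a + 1) vertices besides its beads and room for more than a² beads.  Choosing a just
-- above √n gives n vertices of which all but O(√n) are deleted.  The limit follows, as
-- 1 − PS(n)/n is non-negative and at most a constant times 1/√n.

open import Defs
open import Data.Bool using (T)
open import Data.Empty using (⊥; ⊥-elim; ⊥-elim-irr)
open import Data.Fin using (Fin; zero; suc; toℕ; fromℕ; inject₁; lower₁)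
import Data.Fin.Properties as Fin
import Data.Integer as ℤ
open import Data.Integer using (+_; -[1+_])
import Data.Integer.Properties as ℤ
open import Data.Irrelevant using ([_])
import Data.Nat as ℕ
open import Data.Nat
  using (ℕ; zero; suc; z≤n; s≤s; _≤_; _+_; _*_; _∸_; _^_; _%_; NonZero)
open import Data.Nat.Coprimality using (Coprime; coprime-divisor; coprime-+; 1-coprimeTo)
open import Data.Nat.Divisibility using (_∣_; divides; ∣⇒≤; *-monoˡ-∣)
open import Data.Nat.DivMod
  using (_mod_; m≡m%n+[m/n]*n; %-distribˡ-+; m%n%n≡m%n; [m+n]%n≡m%n; m%n<n; m<n⇒m%n≡m)
  renaming (_/_ to _div_)
import Data.Nat.Properties as ℕ
open import Data.Nat.Tactic.RingSolver using (solve-∀)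
open import Data.Product using (∃; _×_; _,_; proj₁; proj₂)
import Data.Rational as ℚ
open import Data.Rational using (0ℚ; 1ℚ; mkℚ; ∣_∣; _/_; _-_; _<_)
import Data.Rational.Properties as ℚ
import Data.Rational.Unnormalised as ℚᵘ
open import Data.Rational.Unnormalised using (mkℚᵘ; *<*)
import Data.Rational.Unnormalised.Properties as ℚᵘ
open import Data.Refinement
  using (value; value-injective) renaming (_,_ to _,ᵣ_)
open import Data.Sum using (_⊎_; inj₁; inj₂) renaming (map to ⊎-map)
open import Data.Sum.Function.Propositional using (_⊎-↔_)
open import Data.Sum.Properties using (inj₁-injective; inj₂-injective; ≡-dec)
open import Data.Vec using (_∷_) renaming (map to mapᵛ)
open import Data.Vec.Properties using (lookup-map)
import Data.Vec.Relation.Unary.All as All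
open import Data.Vec.Relation.Unary.All.Properties using () renaming (map⁺ to All-map⁺)
open import Data.Vec.Relation.Unary.AllPairs using (_∷_)
open import Data.Vec.Relation.Unary.Unique.Propositional using (Unique)
import Data.Vec.Relation.Unary.Unique.Propositional.Properties as Unique
open import Function using (_∘_; id)
open import Function.Bundles
  using (_↔_; mk↔ₛ′; _⇔_; mk⇔; module Injection; module Inverse)
open import Function.Properties.Inverse using (↔-refl; ↔-sym; ↔-trans; ↔⇒↣)
open import Level using (0ℓ)
open import Relation.Binary.Construct.Closure.ReflexiveTransitive
  using (Star; ε; _◅_; _◅◅_; gmap; reverse)
open import Relation.Binary.Definitions using (DecidableEquality)
open import Relation.Binary.PropositionalEquality
  using (_≡_; _≢_; refl; sym; trans; cong; cong₂; subst; subst₂; ≢-sym; module ≡-Reasoning)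
open import Relation.Nullary using (¬_; Dec; yes; no; does; ¬?)
open import Relation.Nullary.Decidable using (_⊎-dec_; does-⇔; dec-true; dec-false)
open import Relation.Unary using (Pred; _∉_; ｛_｝)

private variable
  V W U : Set

-- Isomorphisms and vertex deletion

image : {G : Graph V} {H : Graph W} → G ≅ H → V → W
image φ = Inverse.to (bijection φ)

≅-sym : {G : Graph V} {H : Graph W} → G ≅ H → H ≅ G
≅-sym {H = H} φ = record
  { bijection    = ↔-sym (bijection φ)
  ; adj-preserve = λ x y → trans
      (cong₂ (adj H) (sym (strictlyInverseˡ x)) (sym (strictlyInverseˡ y)))
      (sym (adj-preserve φ (from x) (from y)))
  }
  where open Inverse (bijection φ)

≅-trans : {G : Graph V} {H : Graph W} {K : Graph U} → G ≅ H → H ≅ K → G ≅ K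
≅-trans φ ψ = record
  { bijection    = ↔-trans (bijection φ) (bijection ψ)
  ; adj-preserve = λ x y → trans (adj-preserve φ x y) (adj-preserve ψ _ _)
  }

image-injective : {G : Graph V} {H : Graph W} (φ : G ≅ H) →
                  ∀ {x y} → image φ x ≡ image φ y → x ≡ y
image-injective φ = Injection.injective (↔⇒↣ (bijection φ))

-- Every isomorphism onto a vertex-deleted subgraph below is obtained from an injective,
-- adjacency-preserving map onto the complement of the deleted set.  Non-membership is
-- stored irrelevantly, but being a negation it can be recovered.
onto-∖ : {G : Graph V} {S : Pred V 0ℓ} {H : Graph W} (f : W → V) →
         (∀ {x y} → f x ≡ f y → x ≡ y) →
         (∀ x y → adj H x y ≡ adj G (f x) (f y)) →
         (∀ x → f x ∉ S) →
         (∀ y → y ∉ S → ∃ λ x → f x ≡ y) →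
         H ≅ G ∖ S
onto-∖ f inj pres avoids covers = record
  { bijection = mk↔ₛ′
      (λ x → f x ,ᵣ [ avoids x ])
      (λ (y ,ᵣ [ y∉S ]) → proj₁ (covers y (λ y∈S → ⊥-elim-irr (y∉S y∈S))))
      (λ (y ,ᵣ [ y∉S ]) →
         value-injective (proj₂ (covers y (λ y∈S → ⊥-elim-irr (y∉S y∈S)))))
      (λ x → inj (proj₂ (covers (f x) _)))
  ; adj-preserve = pres
  }

∖-≅ : {G : Graph V} {H : Graph W} {S : Pred V 0ℓ} {T : Pred W 0ℓ} (φ : G ≅ H) →
      (∀ x → S x → T (image φ x)) → (∀ x → T (image φ x) → S x) →
      G ∖ S ≅ H ∖ T
∖-≅ {H = H} {T = T} φ S⇒T T⇒S = onto-∖ {G = H}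
  (λ x → to (value x))
  (λ eq → value-injective (image-injective φ eq))
  (λ x y → adj-preserve φ _ _)
  (λ (x ,ᵣ [ x∉S ]) Tx → ⊥-elim-irr (x∉S (T⇒S x Tx)))
  (λ y y∉T →
     (from y ,ᵣ [ (λ s → y∉T (subst T (strictlyInverseˡ y) (S⇒T _ s))) ]) ,
     strictlyInverseˡ y)
  where open Inverse (bijection φ)

delete-≅ : {G : Graph V} {H : Graph W} (φ : G ≅ H) → ∀ v →
           G ∖ ｛ v ｝ ≅ H ∖ ｛ image φ v ｝
delete-≅ φ v = ∖-≅ φ (λ _ → cong (image φ)) (λ _ → image-injective φ)

Connected-≅ : {G : Graph V} {H : Graph W} → G ≅ H → Connected G → Connected H
Connected-≅ {H = H} φ conn x y =
  subst₂ (Star _) (strictlyInverseˡ x) (strictlyInverseˡ y)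
    (gmap to (λ {a} {b} → subst T (adj-preserve φ a b)) (conn (from x) (from y)))
  where open Inverse (bijection φ)

-- Transport of mates and chains

HasMate-≅ : {G : Graph V} {H : Graph W} (φ : G ≅ H) → ∀ {v w} → image φ v ≡ w →
            HasMate G v → HasMate H w
HasMate-≅ φ {v} refl (u , removal , ¬similar) =
  image φ u ,
  ≅-trans (≅-sym (delete-≅ φ u)) (≅-trans removal (delete-≅ φ v)) ,
  λ (ψ , eq) → ¬similar
    (≅-trans φ (≅-trans ψ (≅-sym φ)) ,
     trans (cong (Inverse.from (bijection φ)) eq) (Inverse.strictlyInverseʳ (bijection φ) v))

ActiveChain-≅ : {G : Graph V} {H : Graph W} {k : ℕ} → G ≅ H → ActiveChain G k → ActiveChain H k
ActiveChain-≅ {G = G} {H} φ c = record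
  { vertices = mapᵛ f vs
  ; distinct = Unique.map⁺ (image-injective φ) (distinct c)
  ; active   = λ j → HasMate-≅ (∖-≅ {G = G} {H = H} φ
        (λ { _ (i , i<j , refl) → i , i<j , lookup-map i f vs })
        (λ x (i , i<j , eq) → i , i<j , image-injective φ (trans (sym (lookup-map i f vs)) eq)))
      (value-injective (sym (lookup-map j f vs)))
      (active c j)
  }
  where
  f  = image φ
  vs = vertices c

-- Deleting v first and then further vertices is, up to isomorphism, the same as deleting
-- all of them at once (flatten), so v can be put in front of a chain of G without v.
chain-∷ : {G : Graph V} {k : ℕ} (v : V) → HasMate G v → ActiveChain (G ∖ ｛ v ｝) k →
          ActiveChain G (suc k)
chain-∷ {G = G} v mate c = record
  { vertices = vs
  ; distinct = unique
  ; active   = λ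
      { zero    → HasMate-≅ {G = G} {H = G ∖ Before vs zero} none refl mate
      ; (suc j) → HasMate-≅ {G = G ∖ ｛ v ｝ ∖ Before vs′ j} {H = G ∖ Before vs (suc j)} (flatten j)
                    (value-injective (sym (lookup-map j value vs′))) (active c j)
      }
  }
  where
  vs′ = vertices c
  vs  = v ∷ mapᵛ value vs′

  v∉ : ∀ x → v ≡ value {P = _∉ ｛ v ｝} x → ⊥
  v∉ (_ ,ᵣ [ x∉ ]) v≡x = ⊥-elim-irr (x∉ v≡x)

  unique : Unique vs
  unique = All-map⁺ (All.universal v∉ vs′) ∷ Unique.map⁺ value-injective (distinct c)

  none : G ≅ G ∖ Before vs zero
  none = onto-∖ {G = G} id id (λ _ _ → refl) (λ { _ (_ , () , _) }) (λ y _ → y , refl)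

  flatten : ∀ j → G ∖ ｛ v ｝ ∖ Before vs′ j ≅ G ∖ Before vs (suc j)
  flatten j = onto-∖ {G = G} (λ x → value (value x))
    (λ eq → value-injective (value-injective eq))
    (λ _ _ → refl)
    (λ { (x ,ᵣ _) (zero , _ , v≡x) → v∉ x v≡x
       ; (x ,ᵣ [ x∉ ]) (suc i , s≤s i<j , eq) →
           ⊥-elim-irr (x∉ (i , i<j ,
             value-injective (trans (sym (lookup-map i value vs′)) eq))) })
    (λ y y∉ →
       ((y ,ᵣ [ (λ { refl → y∉ (zero , s≤s z≤n , refl) }) ]) ,ᵣ
        [ (λ (i , i<j , eq) →
             y∉ (suc i , s≤s i<j , trans (lookup-map i value vs′) (cong value eq))) ]) ,
       refl)

-- The beaded graphs

does-≡⇒ : {A B : Set} (a? : Dec A) (b? : Dec B) → does a? ≡ does b? → A → B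
does-≡⇒ a? (yes b) _  _ = b
does-≡⇒ a? (no _)  eq a with () ← trans (sym (dec-true a? a)) eq

-- I is the set of positions and next moves each of them one step along its cycle; p and q
-- walk along disjoint cycles.  The pairs (p t , q t) with t < N are distinct.
module Necklace
  {I : Set} (_≟_ : DecidableEquality I)
  (next : I ↔ I) (p q : ℕ → I)
  (p-next : ∀ t → Inverse.to next (p t) ≡ p (suc t))
  (q-next : ∀ t → Inverse.to next (q t) ≡ q (suc t))
  (p-moves : ∀ t → p t ≢ p (suc t))
  (q-moves : ∀ t → q t ≢ q (suc t))
  (p≢q : ∀ s t → p s ≢ q t)
  (N : ℕ)
  (period : ∀ {s t} → s ℕ.< N → t ℕ.< N → p s ≡ p t → q s ≡ q t → s ≡ t)
  where

  -- The two positions occupied at time t.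
  At : ℕ → I → Set
  At t i = i ≡ p t ⊎ i ≡ q t

  At? : ∀ t i → Dec (At t i)
  At? t i = (i ≟ p t) ⊎-dec (i ≟ q t)

  next-injective : ∀ {i j} → Inverse.to next i ≡ Inverse.to next j → i ≡ j
  next-injective = Injection.injective (↔⇒↣ next)

  At-next : ∀ t i → At t i ⇔ At (suc t) (Inverse.to next i)
  At-next t i = mk⇔
    (λ { (inj₁ refl) → inj₁ (p-next t) ; (inj₂ refl) → inj₂ (q-next t) })
    (⊎-map (λ eq → next-injective (trans eq (sym (p-next t))))
           (λ eq → next-injective (trans eq (sym (q-next t)))))

  At-moves : ∀ {t i} → At t i → ¬ At (suc t) i
  At-moves (inj₁ refl) (inj₁ eq) = p-moves _ eq
  At-moves (inj₁ refl) (inj₂ eq) = p≢q _ _ eq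
  At-moves (inj₂ refl) (inj₁ eq) = p≢q _ _ (sym eq)
  At-moves (inj₂ refl) (inj₂ eq) = q-moves _ eq

  At-unique : ∀ {s t} → s ℕ.< N → t ℕ.< N → (∀ i → At s i → At t i) → s ≡ t
  At-unique s<N t<N f with f _ (inj₁ refl) | f _ (inj₂ refl)
  ... | inj₁ ps≡pt | inj₂ qs≡qt = period s<N t<N ps≡pt qs≡qt
  ... | inj₂ ps≡qt | _          = ⊥-elim (p≢q _ _ ps≡qt)
  ... | _          | inj₁ qs≡pt = ⊥-elim (p≢q _ _ (sym qs≡pt))

  partner : ∀ {t i} → At t i → ∃ λ j → At t j × i ≢ j
  partner (inj₁ refl) = _ , inj₂ refl , p≢q _ _
  partner (inj₂ refl) = _ , inj₁ refl , p≢q _ _ ∘ sym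

  -- A hub and a spur at each position, and k beads.
  Vertex : ℕ → Set
  Vertex k = (I ⊎ I) ⊎ Fin k

  pattern hub i  = inj₁ (inj₁ i)
  pattern spur i = inj₁ (inj₂ i)
  pattern bead t = inj₂ t

  hub-injective : ∀ {k i j} → _≡_ {A = Vertex k} (hub i) (hub j) → i ≡ j
  hub-injective = inj₁-injective ∘ inj₁-injective

  spur-injective : ∀ {k i j} → _≡_ {A = Vertex k} (spur i) (spur j) → i ≡ j
  spur-injective = inj₂-injective ∘ inj₁-injective

  bead-injective : ∀ {k} {s t : Fin k} → _≡_ {A = Vertex k} (bead s) (bead t) → s ≡ t
  bead-injective = inj₂-injective

  infix 4 _~_ _~?_

  -- Adjacency in Γ k.
  _~_ : ∀ {k} → Vertex k → Vertex k → Set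
  hub i  ~ hub j  = i ≢ j
  hub i  ~ spur j = i ≡ j
  hub i  ~ bead t = At (toℕ t) i
  spur i ~ hub j  = j ≡ i
  spur i ~ spur j = ⊥
  spur i ~ bead t = At (suc (toℕ t)) i
  bead t ~ hub i  = At (toℕ t) i
  bead t ~ spur i = At (suc (toℕ t)) i
  bead s ~ bead t = ⊥

  _~?_ : ∀ {k} (x y : Vertex k) → Dec (x ~ y)
  hub i  ~? hub j  = ¬? (i ≟ j)
  hub i  ~? spur j = i ≟ j
  hub i  ~? bead t = At? (toℕ t) i
  spur i ~? hub j  = j ≟ i
  spur i ~? spur j = no λ ()
  spur i ~? bead t = At? (suc (toℕ t)) i
  bead t ~? hub i  = At? (toℕ t) i
  bead t ~? spur i = At? (suc (toℕ t)) i
  bead s ~? bead t = no λ ()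

  ~-sym : ∀ {k} (x y : Vertex k) → x ~ y → y ~ x
  ~-sym (hub i)  (hub j)  r = ≢-sym r
  ~-sym (hub i)  (spur j) r = r
  ~-sym (hub i)  (bead t) r = r
  ~-sym (spur i) (hub j)  r = r
  ~-sym (spur i) (bead t) r = r
  ~-sym (bead t) (hub i)  r = r
  ~-sym (bead t) (spur i) r = r

  ~-irrefl : ∀ {k} (x : Vertex k) → ¬ (x ~ x)
  ~-irrefl (hub i) r = r refl

  Γ : ∀ k → Graph (Vertex k)
  Γ k = record
    { adj        = λ x y → does (x ~? y)
    ; adj-sym    = λ x y → does-⇔ (mk⇔ (~-sym x y) (~-sym y x)) (x ~? y) (y ~? x)
    ; adj-irrefl = λ x → dec-false (x ~? x) (~-irrefl x)
    }

  -- Each end bead of Γ (k + 1) can be deleted to leave Γ k.  For the first one, the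
  -- remaining beads are renumbered, and the positions move along by one step.

  delete-first : ∀ k → Γ k ≅ Γ (suc k) ∖ ｛ bead zero ｝
  delete-first k = onto-∖ {G = Γ (suc k)} f inj
    (λ x y → does-⇔ (pres x y) (x ~? y) (f x ~? f y))
    (λ { (hub _) () ; (spur _) () ; (bead _) () })
    (λ { (hub i)        _ → hub (from i) , cong (λ z → hub z) (strictlyInverseˡ i)
       ; (spur i)       _ → spur (from i) , cong (λ z → spur z) (strictlyInverseˡ i)
       ; (bead zero)    ∉ → ⊥-elim (∉ refl)
       ; (bead (suc t)) _ → bead t , refl })
    where
    open Inverse next

    f : Vertex k → Vertex (suc k)
    f (hub i)  = hub (to i)
    f (spur i) = spur (to i)
    f (bead t) = bead (suc t)

    inj : ∀ {x y} → f x ≡ f y → x ≡ y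
    inj {hub i}  {hub j}  eq = cong (λ z → hub z) (next-injective (hub-injective eq))
    inj {spur i} {spur j} eq = cong (λ z → spur z) (next-injective (spur-injective eq))
    inj {bead s} {bead t} refl = refl
    inj {bead _} {hub _}  ()
    inj {bead _} {spur _} ()

    pres : ∀ x y → x ~ y ⇔ f x ~ f y
    pres (hub i)  (hub j)  = mk⇔ (λ i≢j → i≢j ∘ next-injective) (λ ne → ne ∘ cong to)
    pres (hub i)  (spur j) = mk⇔ (cong to) next-injective
    pres (hub i)  (bead t) = At-next (toℕ t) i
    pres (spur i) (hub j)  = mk⇔ (cong to) next-injective
    pres (spur i) (spur j) = mk⇔ (λ ()) (λ ())
    pres (spur i) (bead t) = At-next (suc (toℕ t)) i
    pres (bead t) (hub i)  = At-next (toℕ t) i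
    pres (bead t) (spur i) = At-next (suc (toℕ t)) i
    pres (bead s) (bead t) = mk⇔ (λ ()) (λ ())

  delete-last : ∀ k → Γ k ≅ Γ (suc k) ∖ ｛ bead (fromℕ k) ｝
  delete-last k = onto-∖ {G = Γ (suc k)} f inj
    (λ x y → does-⇔ (pres x y) (x ~? y) (f x ~? f y))
    (λ { (hub _) () ; (spur _) () ; (bead t) eq → Fin.fromℕ≢inject₁ (bead-injective eq) })
    (λ { (hub i)  _ → hub i , refl
       ; (spur i) _ → spur i , refl
       ; (bead t) ∉ →
           let k≢t = λ eq → ∉ (cong bead (Fin.toℕ-injective (trans (Fin.toℕ-fromℕ k) eq)))
           in bead (lower₁ t k≢t) , cong bead (Fin.inject₁-lower₁ t k≢t) })
    where
    f : Vertex k → Vertex (suc k)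
    f (hub i)  = hub i
    f (spur i) = spur i
    f (bead t) = bead (inject₁ t)

    inj : ∀ {x y} → f x ≡ f y → x ≡ y
    inj {hub i}  {hub j}  refl = refl
    inj {spur i} {spur j} refl = refl
    inj {bead s} {bead t} eq   = cong bead (Fin.inject₁-injective (bead-injective eq))
    inj {bead _} {hub _}  ()
    inj {bead _} {spur _} ()

    At-inject₁ : ∀ t i → At (toℕ t) i ⇔ At (toℕ (inject₁ t)) i
    At-inject₁ t i rewrite Fin.toℕ-inject₁ t = mk⇔ id id

    At-suc-inject₁ : ∀ t i → At (suc (toℕ t)) i ⇔ At (suc (toℕ (inject₁ t))) i
    At-suc-inject₁ t i rewrite Fin.toℕ-inject₁ t = mk⇔ id id

    pres : ∀ x y → x ~ y ⇔ f x ~ f y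
    pres (hub i)  (hub j)  = mk⇔ id id
    pres (hub i)  (spur j) = mk⇔ id id
    pres (hub i)  (bead t) = At-inject₁ t i
    pres (spur i) (hub j)  = mk⇔ id id
    pres (spur i) (spur j) = mk⇔ id id
    pres (spur i) (bead t) = At-suc-inject₁ t i
    pres (bead t) (hub i)  = At-inject₁ t i
    pres (bead t) (spur i) = At-suc-inject₁ t i
    pres (bead s) (bead t) = mk⇔ id id

  -- The two hubs of a bead are its only neighbours that are adjacent to each other: its
  -- spurs sit one step further on.
  triangle : ∀ {n} (t : Fin n) (x y : Vertex n) → x ~ bead t → y ~ bead t → x ~ y →
             ∃ λ j → x ≡ hub j × At (toℕ t) j
  triangle t (hub i)  y        at _   _    = i , refl , at
  triangle t (spur i) (hub j)  at at′ refl = ⊥-elim (At-moves at′ at)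

  -- If k + 2 < N, no automorphism of Γ (k + 2) takes the first bead to the last (impossible).
  module _ {k : ℕ} (φ : Γ (suc (suc k)) ≅ Γ (suc (suc k))) where
    private
      F : Vertex (suc (suc k)) → Vertex (suc (suc k))
      F = image φ
      L : ℕ
      L = suc k
      last : Fin (suc (suc k))
      last = fromℕ L

    F-~ : ∀ x y → x ~ y → F x ~ F y
    F-~ x y = does-≡⇒ (x ~? y) (F x ~? F y) (adj-preserve φ x y)

    F-reflects-~ : ∀ x y → F x ~ F y → x ~ y
    F-reflects-~ x y = does-≡⇒ (F x ~? F y) (x ~? y) (sym (adj-preserve φ x y))

    F-injective : ∀ {x y} → F x ≡ F y → x ≡ y
    F-injective = image-injective φ

    hub-images-differ : ∀ s {j} → F (hub (p s)) ≡ hub j → F (hub (q s)) ≢ hub j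
    hub-images-differ s e e′ = p≢q s s (hub-injective (F-injective (trans e (sym e′))))

    -- The hubs at time s are mapped to hubs at time t.
    Into : ℕ → ℕ → Set
    Into s t = ∀ i → At s i → ∃ λ j → F (hub i) ≡ hub j × At t j

    -- The hubs at time t are images of hubs at time s.
    Onto : ℕ → ℕ → Set
    Onto s t = ∀ j → At t j → ∃ λ i → At s i × F (hub i) ≡ hub j

    -- An injective map between two-element sets is onto.
    onto : ∀ {s t} → Into s t → Onto s t
    onto {s} f with f _ (inj₁ refl) | f _ (inj₂ refl)
    ... | _ , e , inj₁ refl | _ , e′ , inj₁ refl = ⊥-elim (hub-images-differ s e e′)
    ... | _ , e , inj₂ refl | _ , e′ , inj₂ refl = ⊥-elim (hub-images-differ s e e′)
    ... | _ , e , inj₁ refl | _ , e′ , inj₂ refl =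
      λ { _ (inj₁ refl) → _ , inj₁ refl , e ; _ (inj₂ refl) → _ , inj₂ refl , e′ }
    ... | _ , e , inj₂ refl | _ , e′ , inj₁ refl =
      λ { _ (inj₁ refl) → _ , inj₂ refl , e′ ; _ (inj₂ refl) → _ , inj₁ refl , e }

    module _ (2+k<N : suc (suc k) ℕ.< N) (first↦last : F (bead zero) ≡ bead last) where

      next-to-last : ∀ x → x ~ bead zero → F x ~ bead last
      next-to-last x r = subst (F x ~_) first↦last (F-~ x (bead zero) r)

      hubs₀ : Into 0 L
      hubs₀ i at with partner at
      ... | i′ , at′ , i≢i′
        with triangle last (F (hub i)) (F (hub i′)) (next-to-last (hub i) at)
               (next-to-last (hub i′) at′) (F-~ (hub i) (hub i′) i≢i′)
      ... | j , e , at″ = j , e , subst (λ t → At t j) (Fin.toℕ-fromℕ L) at″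

      -- The hubs of the last bead are already images of the hubs at time 0, so the spurs of
      -- bead 0 are mapped to the spurs of the last bead.
      spurs₁ : ∀ i → At 1 i → ∃ λ j → F (spur i) ≡ spur j × At (suc L) j
      spurs₁ i at with F (spur i) in e | next-to-last (spur i) at
      ... | spur j | at′ = j , refl , subst (λ t → At (suc t) j) (Fin.toℕ-fromℕ L) at′
      ... | hub j  | at′ with onto hubs₀ j (subst (λ t → At t j) (Fin.toℕ-fromℕ L) at′)
      ... | i′ , _ , e′ with () ← F-injective (trans e (sym e′))

      sees-hubs₀ : ∀ x → (∀ i → At 0 i → x ~ hub i) → ∀ j → At L j → F x ~ hub j
      sees-hubs₀ x r j at with onto hubs₀ j at
      ... | i , at′ , e = subst (F x ~_) e (F-~ x (hub i) (r i at′))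

      L<N : L ℕ.< N
      L<N = ℕ.<-trans (ℕ.n<1+n L) 2+k<N

      bead<N : ∀ (t : Fin (suc L)) → toℕ t ℕ.< N
      bead<N t = ℕ.<-trans (Fin.toℕ<n t) 2+k<N

      -- The hub at i is adjacent to the spur at i and to both hubs at time 0, and the only
      -- bead with the images of the latter as neighbours is the last one, which is taken.
      hubs₁ : Into 1 (suc L)
      hubs₁ i at with spurs₁ i at
      ... | j , e , at′
        with F (hub i) in e′
           | subst (F (hub i) ~_) e (F-~ (hub i) (spur i) refl)
           | sees-hubs₀ (hub i) (λ { _ at₀ refl → At-moves at₀ at })
      ... | hub _  | refl | _ = j , refl , at′
      ... | bead t | _    | sees
        with refl ← Fin.toℕ-injective (trans (Fin.toℕ-fromℕ L) (At-unique L<N (bead<N t) sees))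
        with () ← F-injective (trans e′ (sym first↦last))

      sees-hubs₁ : ∀ j → At (suc L) j → F (bead (suc zero)) ~ hub j
      sees-hubs₁ j at with onto hubs₁ j at
      ... | i , at′ , e = subst (F (bead (suc zero)) ~_) e (F-~ (bead (suc zero)) (hub i) at′)

      -- The image of bead 1 is adjacent to both hubs at time k + 2.  It is not one of the
      -- beads, whose numbers are at most k + 1, nor a spur, which has only one hub.  If it
      -- were a hub, it would be adjacent to the image of the hub at p 0 or equal to it, but
      -- bead 1 is neither adjacent nor equal to that hub.
      impossible : ⊥
      impossible with F (bead (suc zero)) in e | sees-hubs₁
      ... | bead t | sees = ℕ.<-irrefl
              (sym (At-unique 2+k<N (bead<N t) sees)) (Fin.toℕ<n t)
      ... | spur j | sees = p≢q (suc L) (suc L)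
              (trans (sees _ (inj₁ refl)) (sym (sees _ (inj₂ refl))))
      ... | hub j | _ with hubs₀ (p 0) (inj₁ refl)
      ... | j′ , e′ , _ with j ≟ j′
      ... | yes refl with () ← F-injective (trans e (sym e′))
      impossible | hub j | _ | j′ , e′ , _ | no j≢j′ =
        At-moves (inj₁ refl)
          (F-reflects-~ (bead (suc zero)) (hub (p 0)) (subst₂ _~_ (sym e) (sym e′) j≢j′))

  last-has-mate : ∀ k → suc (suc k) ℕ.< N → HasMate (Γ (suc (suc k))) (bead (fromℕ (suc k)))
  last-has-mate k 2+k<N = bead zero ,
    ≅-trans (≅-sym (delete-first (suc k))) (delete-last (suc k)) ,
    λ (φ , eq) → impossible φ 2+k<N eq

  -- Only the beads are deleted, and the deletion stops with one bead left.
  chain : ∀ k → suc k ℕ.< N → ActiveChain (Γ (suc k)) k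
  chain zero    _     = emptyChain _
  chain (suc k) 2+k<N = chain-∷ (bead (fromℕ (suc k))) (last-has-mate k 2+k<N)
    (ActiveChain-≅ (delete-last (suc k)) (chain k (ℕ.<-trans (ℕ.n<1+n _) 2+k<N)))

  connected : ∀ k → Connected (Γ k)
  connected k x y = to-hub x ◅◅ reverse (λ {a} {b} → subst T (adj-sym (Γ k) a b)) (to-hub y)
    where
    edge : ∀ {x y} → x ~ y → T (adj (Γ k) x y)
    edge {x} {y} r = subst T (sym (dec-true (x ~? y) r)) _

    hub-hub : ∀ i → Star (λ a b → T (adj (Γ k) a b)) (hub i) (hub (p 0))
    hub-hub i with i ≟ p 0
    ... | yes refl = ε
    ... | no i≢p   = edge {hub i} {hub (p 0)} i≢p ◅ ε

    to-hub : ∀ x → Star (λ a b → T (adj (Γ k) a b)) x (hub (p 0))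
    to-hub (hub i)  = hub-hub i
    to-hub (spur i) = edge {spur i} {hub i} refl ◅ hub-hub i
    to-hub (bead t) = edge {bead t} {hub (p (toℕ t))} (inj₁ refl) ◅ hub-hub _

-- Residues and the two cycles

toℕ-mod : ∀ t n .{{_ : NonZero n}} → toℕ (t mod n) ≡ t % n
toℕ-mod t n = Fin.toℕ-fromℕ< (m%n<n t n)

mod-cong : ∀ {s t} n .{{_ : NonZero n}} → s % n ≡ t % n → s mod n ≡ t mod n
mod-cong {s} {t} n eq =
  Fin.toℕ-injective (trans (toℕ-mod s n) (trans eq (sym (toℕ-mod t n))))

mod-cong⁻¹ : ∀ {s t} n .{{_ : NonZero n}} → s mod n ≡ t mod n → s % n ≡ t % n
mod-cong⁻¹ {s} {t} n eq = trans (sym (toℕ-mod s n)) (trans (cong toℕ eq) (toℕ-mod t n))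

mod-toℕ : ∀ {n} .{{_ : NonZero n}} (i : Fin n) → toℕ i mod n ≡ i
mod-toℕ {n} i = Fin.toℕ-injective (trans (toℕ-mod (toℕ i) n) (m<n⇒m%n≡m (Fin.toℕ<n i)))

[k+m%n]%n : ∀ k m n .{{_ : NonZero n}} → (k + m % n) % n ≡ (k + m) % n
[k+m%n]%n k m n = begin
  (k + m % n) % n           ≡⟨ %-distribˡ-+ k (m % n) n ⟩
  (k % n + m % n % n) % n   ≡⟨ cong (λ x → (k % n + x) % n) (m%n%n≡m%n m n) ⟩
  (k % n + m % n) % n       ≡⟨ %-distribˡ-+ k m n ⟨
  (k + m) % n               ∎
  where open ≡-Reasoning

shift-mod : ∀ k t n .{{_ : NonZero n}} → (k + toℕ (t mod n)) mod n ≡ (k + t) mod n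
shift-mod k t n = mod-cong n
  (trans (cong (λ x → (k + x) % n) (toℕ-mod t n)) ([k+m%n]%n k t n))

-- The rotation i ↦ i + 1 of ℤ/(m + 1); its inverse adds m.
rotate : ∀ m → Fin (suc m) ↔ Fin (suc m)
rotate m = mk↔ₛ′ (λ i → (1 + toℕ i) mod n) (λ i → (m + toℕ i) mod n)
  (λ i → trans (shift-mod 1 (m + toℕ i) n) (full-turn i))
  (λ i → trans (shift-mod m (1 + toℕ i) n)
    (trans (cong (_mod n) (ℕ.+-suc m (toℕ i))) (full-turn i)))
  where
  n = suc m
  full-turn : ∀ i → (n + toℕ i) mod n ≡ i
  full-turn i = trans
    (mod-cong {n + toℕ i} {toℕ i} n (trans (cong (_% n) (ℕ.+-comm n (toℕ i))) ([m+n]%n≡m%n (toℕ i) n)))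
    (mod-toℕ i)

%≡⇒∣∸ : ∀ s t n .{{_ : NonZero n}} → s % n ≡ t % n → n ∣ t ∸ s
%≡⇒∣∸ s t n eq = divides (t div n ∸ s div n) (begin
  t ∸ s
    ≡⟨ cong₂ _∸_ (m≡m%n+[m/n]*n t n) (m≡m%n+[m/n]*n s n) ⟩
  (t % n + t div n * n) ∸ (s % n + s div n * n)
    ≡⟨ cong (λ r → (t % n + t div n * n) ∸ (r + s div n * n)) eq ⟩
  (t % n + t div n * n) ∸ (t % n + s div n * n)
    ≡⟨ ℕ.[m+n]∸[m+o]≡n∸o (t % n) _ _ ⟩
  t div n * n ∸ s div n * n
    ≡⟨ ℕ.*-distribʳ-∸ n (t div n) (s div n) ⟨
  (t div n ∸ s div n) * n
    ∎)
  where open ≡-Reasoning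

coprime⇒*∣ : ∀ {a b n} → Coprime a b → a ∣ n → b ∣ n → a * b ∣ n
coprime⇒*∣ {a} {b} c a∣n (divides r refl) =
  *-monoˡ-∣ b (coprime-divisor c (subst (a ∣_) (ℕ.*-comm r b) a∣n))

chinese-remainder : ∀ {a b s t} .{{_ : NonZero a}} .{{_ : NonZero b}} → Coprime a b →
                    s ℕ.< a * b → t ℕ.< a * b → s % a ≡ t % a → s % b ≡ t % b → s ≡ t
chinese-remainder {a} {b} {s} {t} c s<ab t<ab ea eb = ℕ.≤-antisym
  (at-most s t s<ab (sym ea) (sym eb))
  (at-most t s t<ab ea eb)
  where
  at-most : ∀ x y → x ℕ.< a * b → y % a ≡ x % a → y % b ≡ x % b → x ≤ y
  at-most x y x<ab ea eb with x ∸ y in eq | coprime⇒*∣ c (%≡⇒∣∸ y x a ea) (%≡⇒∣∸ y x b eb)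
  ... | zero  | _   = ℕ.m∸n≡0⇒m≤n eq
  ... | suc _ | ab∣ = ⊥-elim (ℕ.<⇒≱ x<ab
    (ℕ.≤-trans (∣⇒≤ ab∣) (subst (_≤ x) eq (ℕ.m∸n≤m x y))))

suc-mod≢ : ∀ n .{{_ : NonZero n}} → 1 ℕ.< n → ∀ t → t mod n ≢ suc t mod n
suc-mod≢ n 1<n t eq = ℕ.<⇒≱ 1<n
  (∣⇒≤ (subst (n ∣_) (ℕ.m+n∸n≡m 1 t) (%≡⇒∣∸ t (suc t) n (mod-cong⁻¹ {t} {suc t} n eq))))

coprime-suc : ∀ n → Coprime n (suc n)
coprime-suc n {d} (d∣n , d∣1+n) =
  coprime-+ {1} {n} (1-coprimeTo n) (subst (d ∣_) (ℕ.+-comm 1 n) d∣1+n , d∣n)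

-- H with its vertices renamed along a bijection.
relabel : {V W : Set} → Graph W → V ↔ W → Graph V
relabel H e = record
  { adj        = λ x y → adj H (to x) (to y)
  ; adj-sym    = λ x y → adj-sym H (to x) (to y)
  ; adj-irrefl = λ x → adj-irrefl H (to x)
  }
  where open Inverse e

relabel-≅ : {V W : Set} (H : Graph W) (e : V ↔ W) → H ≅ relabel H e
relabel-≅ H e = ≅-sym (record { bijection = e ; adj-preserve = λ _ _ → refl })

-- The necklace on cycles of lengths m + 1 and m + 2.  All its beads but one can be
-- deleted.
deep-graph : ∀ m k → 1 ≤ m → suc k ℕ.< suc m * (2 + m) →
             let n = ((suc m + (2 + m)) + (suc m + (2 + m))) + suc k in
             ∃ λ (G : Graph (Fin n)) → Connected G × k ≤ psd G
deep-graph m k 1≤m bound = G , Connected-≅ iso (connected (suc k)) ,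
  proj₂ (psd-isMaximum G) k (ActiveChain-≅ iso (chain k bound))
  where
  a = suc m
  b = suc (suc m)
  open Necklace (≡-dec Fin._≟_ Fin._≟_) (rotate m ⊎-↔ rotate (suc m))
    (λ t → inj₁ (t mod a)) (λ t → inj₂ (t mod b))
    (λ t → cong inj₁ (shift-mod 1 t a)) (λ t → cong inj₂ (shift-mod 1 t b))
    (λ t eq → suc-mod≢ a (s≤s 1≤m) t (inj₁-injective eq))
    (λ t eq → suc-mod≢ b (s≤s (s≤s z≤n)) t (inj₂-injective eq))
    (λ _ _ ())
    (a * b)
    (λ {s} {t} s< t< ea eb → chinese-remainder (coprime-suc a) s< t<
      (mod-cong⁻¹ {s} {t} a (inj₁-injective ea)) (mod-cong⁻¹ {s} {t} b (inj₂-injective eb)))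
  e : Fin (((a + b) + (a + b)) + suc k) ↔ Vertex (suc k)
  e = ↔-trans Fin.+↔⊎ (↔-trans Fin.+↔⊎ (Fin.+↔⊎ ⊎-↔ Fin.+↔⊎) ⊎-↔ ↔-refl)
  G = relabel (Γ (suc k)) e
  iso = relabel-≅ (Γ (suc k)) e

-- The asymptotics

sqrt : ∀ n → ∃ λ m → m * m ≤ n × n ℕ.< suc m * suc m
sqrt zero = 0 , z≤n , s≤s z≤n
sqrt (suc n) with sqrt n
... | m , m²≤n , n<m′² with suc n ℕ.<? suc m * suc m
... | yes n′<m′² = m , ℕ.m≤n⇒m≤1+n m²≤n , n′<m′²
... | no  n′≮m′² = suc m , ℕ.≮⇒≥ n′≮m′² ,
  ℕ.≤-<-trans n<m′² (ℕ.*-mono-< (ℕ.n<1+n (suc m)) (ℕ.n<1+n (suc m)))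

square-bound : ∀ {d m n} C → d ≤ C * m → m * m ≤ n → d ^ 2 ≤ C ^ 2 * n
square-bound {d} {m} {n} C d≤Cm m²≤n = begin
  d ^ 2            ≤⟨ ℕ.^-monoˡ-≤ 2 d≤Cm ⟩
  (C * m) ^ 2      ≡⟨ rearrange C m ⟩
  C ^ 2 * (m * m)  ≤⟨ ℕ.*-monoʳ-≤ (C ^ 2) m²≤n ⟩
  C ^ 2 * n        ∎
  where
  open ℕ.≤-Reasoning
  rearrange : ∀ C m → (C * m) * ((C * m) * 1) ≡ (C * (C * 1)) * (m * m)
  rearrange = solve-∀

scaled-bound : ∀ {d q n} C .{{_ : NonZero n}} →
               d ^ 2 ≤ C ^ 2 * n → C ^ 2 * (q * q) ℕ.< n → d * q ℕ.< n
scaled-bound {d} {q} {n} C d²≤C²n C²q²<n =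
  ℕ.≰⇒> λ n≤dq → ℕ.<⇒≱ squares (ℕ.*-mono-≤ n≤dq n≤dq)
  where
  open ℕ.≤-Reasoning
  rearrange : ∀ d q → (d * q) * (d * q) ≡ (d * (d * 1)) * (q * q)
  rearrange = solve-∀
  rearrange′ : ∀ C n q → (C * (C * 1) * n) * (q * q) ≡ (C * (C * 1)) * (q * q) * n
  rearrange′ = solve-∀
  squares : (d * q) * (d * q) ℕ.< n * n
  squares = begin-strict
    (d * q) * (d * q)      ≡⟨ rearrange d q ⟩
    d ^ 2 * (q * q)        ≤⟨ ℕ.*-monoˡ-≤ (q * q) d²≤C²n ⟩
    (C ^ 2 * n) * (q * q)  ≡⟨ rearrange′ C n q ⟩
    C ^ 2 * (q * q) * n    <⟨ ℕ.*-monoˡ-< n C²q²<n ⟩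
    n * n                  ∎

-- With m the integer square root of n, the cycles have lengths m + 1 and m + 2.  The
-- 4 m + 6 hubs and spurs and one bead are never deleted, and 4 m + 7 ≤ 6 m because n ≥ 36
-- forces m ≥ 6.
deep-graphs : ∀ n → 36 ≤ n → ∃ λ (G : Graph (Fin n)) → Connected G × (psd G ≥ n - 6 √ n)
deep-graphs n 36≤n with sqrt n
... | m , m²≤n , n<m′² = G , proj₁ (proj₂ deep) , depth
  where
  open ℕ.≤-Reasoning

  5<m : 5 ℕ.< m
  5<m = ℕ.≰⇒> λ m≤5 → ℕ.<⇒≱ n<m′² (ℕ.≤-trans (ℕ.*-mono-≤ (s≤s m≤5) (s≤s m≤5)) 36≤n)

  waste≤6m : 7 + 4 * m ≤ 6 * m
  waste≤6m = begin
    7 + 4 * m      ≤⟨ ℕ.+-monoˡ-≤ (4 * m)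
                        (ℕ.≤-trans (ℕ.n≤1+n 7) (ℕ.*-monoʳ-≤ 2 (ℕ.≤-trans (ℕ.m≤n+m 4 2) 5<m))) ⟩
    2 * m + 4 * m  ≡⟨ ℕ.*-distribʳ-+ m 2 4 ⟨
    6 * m          ∎

  waste≤n : 7 + 4 * m ≤ n
  waste≤n = ℕ.≤-trans waste≤6m (ℕ.≤-trans (ℕ.*-monoˡ-≤ m 5<m) m²≤n)

  k = n ∸ (7 + 4 * m)

  vertex-count : ∀ m k → ((suc m + (2 + m)) + (suc m + (2 + m))) + suc k ≡ (7 + 4 * m) + k
  vertex-count = solve-∀

  size : ((suc m + (2 + m)) + (suc m + (2 + m))) + suc k ≡ n
  size = trans (vertex-count m k) (ℕ.m+[n∸m]≡n waste≤n)

  few-beads : suc k ℕ.< suc m * (2 + m)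
  few-beads = begin-strict
    suc k              ≤⟨ ℕ.m≤n+m (suc k) ((suc m + (2 + m)) + (suc m + (2 + m))) ⟩
    _                  ≡⟨ size ⟩
    n                  <⟨ n<m′² ⟩
    suc m * suc m      ≤⟨ ℕ.*-monoʳ-≤ (suc m) (ℕ.n≤1+n (suc m)) ⟩
    suc m * (2 + m)    ∎

  deep : ∃ λ (G : Graph (Fin n)) → Connected G × k ≤ psd G
  deep = subst (λ n → ∃ λ (G : Graph (Fin n)) → Connected G × k ≤ psd G) size
    (deep-graph m k (ℕ.≤-trans (s≤s z≤n) 5<m) few-beads)

  G = proj₁ deep

  depth : psd G ≥ n - 6 √ n
  depth = square-bound {n ∸ psd G} {m} {n} 6 (begin
    n ∸ psd G  ≤⟨ ℕ.∸-monoʳ-≤ n (proj₂ (proj₂ deep)) ⟩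
    n ∸ k      ≡⟨ ℕ.m∸[m∸n]≡n waste≤n ⟩
    7 + 4 * m  ≤⟨ waste≤6m ⟩
    6 * m      ∎) m²≤n

psd≤PS : ∀ {n} (G : Graph (Fin n)) → psd G ≤ PS n
psd≤PS {n} G = proj₂ (PS-isMaximum n) (psd G) (G , refl)

PS≤n : ∀ n → PS n ≤ n
PS≤n n with proj₁ (PS-isMaximum n)
... | G , eq = subst (_≤ n) eq (chain-length≤ (proj₁ (psd-isMaximum G)))

∣k/n-1∣<p/q : ∀ {k n p q-1} .{{_ : NonZero n}} .(c : Coprime (suc p) (suc q-1)) →
            k ≤ n → (n ∸ k) * suc q-1 ℕ.< suc p * n →
            ∣ (+ k) / n - 1ℚ ∣ < mkℚ (+ suc p) q-1 c
∣k/n-1∣<p/q {k} {n@(suc n-1)} {p} {q-1} c k≤n lt = ℚ.toℚᵘ-cancel-< (ℚᵘ.<-respˡ-≃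
  (ℚᵘ.≃-sym difference) (*<* (cross-multiplied lt)))
  where
  difference : ℚ.toℚᵘ ∣ (+ k) / n - 1ℚ ∣ ℚᵘ.≃ ℚᵘ.∣ mkℚᵘ (+ k) n-1 ℚᵘ.- mkℚᵘ (+ 1) 0 ∣
  difference = ℚᵘ.≃-trans (ℚ.toℚᵘ-homo-∣-∣ ((+ k) / n - 1ℚ)) (ℚᵘ.∣-∣-cong
    (ℚᵘ.≃-trans (ℚ.toℚᵘ-homo-+ ((+ k) / n) (ℚ.- 1ℚ))
      (ℚᵘ.+-cong (ℚ.toℚᵘ-fromℚᵘ (mkℚᵘ (+ k) n-1)) ℚᵘ.≃-refl)))
  num : ℤ.∣ + k ℤ.* + 1 ℤ.+ -[1+ 0 ] ℤ.* + n ∣ ≡ n ∸ k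
  num = trans (cong₂ (λ x y → ℤ.∣ x ℤ.+ y ∣) (ℤ.*-identityʳ (+ k)) (ℤ.-1*i≡-i (+ n)))
    (trans (cong ℤ.∣_∣ (ℤ.m-n≡m⊖n k n)) (ℤ.∣⊖∣-≤ k≤n))
  cross-multiplied : (n ∸ k) * suc q-1 ℕ.< suc p * n →
    + ℤ.∣ + k ℤ.* + 1 ℤ.+ -[1+ 0 ] ℤ.* + n ∣ ℤ.* + suc q-1 ℤ.< + suc p ℤ.* + (n * 1)
  cross-multiplied lt
    rewrite num | ℕ.*-identityʳ n-1 | sym (ℤ.pos-* (n ∸ k) (suc q-1)) = ℤ.+<+ lt

-- For ε = p / q with p ≥ 1 it is enough that q (n − PS(n)) < n, which holds as soon as
-- C² q² < n.
limit-of-PS/n : ∀ C N → (∀ n → N ≤ n → PS n ≥ n - C √ n) →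
                ∀ ε → 0ℚ < ε → ∃ λ (N′ : ℕ) → ∀ n → .{{_ : NonZero n}} → N′ ≤ n →
                ∣ (+ (PS n)) / n - 1ℚ ∣ < ε
limit-of-PS/n C N large (mkℚ (+ zero) _ _)   (ℚ.*<* (ℤ.+<+ ()))
limit-of-PS/n C N large (mkℚ (-[1+ _ ]) _ _) (ℚ.*<* ())
limit-of-PS/n C N large (mkℚ (+ suc p) q-1 c) _ =
  -- A sum serves as an upper bound for the two thresholds.
  N + suc (C ^ 2 * (q * q)) , λ n N′≤n → ∣k/n-1∣<p/q c (PS≤n n) (close n N′≤n)
  where
  q = suc q-1

  close : ∀ n .{{_ : NonZero n}} → N + suc (C ^ 2 * (q * q)) ≤ n → (n ∸ PS n) * q ℕ.< suc p * n
  close n N′≤n = ℕ.<-≤-trans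
    (scaled-bound {n ∸ PS n} {q} {n} C (large n (ℕ.m+n≤o⇒m≤o N N′≤n)) (ℕ.m+n≤o⇒n≤o N N′≤n))
    (ℕ.m≤n*m n (suc p))

PS-bound : ∀ {C n} (G : Graph (Fin n)) → psd G ≥ n - C √ n → PS n ≥ n - C √ n
PS-bound {n = n} G = ℕ.≤-trans (ℕ.^-monoˡ-≤ 2 (ℕ.∸-monoʳ-≤ n (psd≤PS G)))

theorem5p4 : (∃ λ (C : ℕ) → ∃ λ (N : ℕ) → ∀ n → N ≤ n →
    ∃ λ (G : Graph (Fin n)) → Connected G × (psd G ≥ n - C √ n))
    ×
    (∀ ε → 0ℚ < ε → ∃ λ (N : ℕ) → ∀ n → .{{_ : NonZero n}} → N ≤ n →
    ∣ (+ (PS n)) / n - 1ℚ ∣ < ε)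
theorem5p4 = (6 , 36 , deep-graphs) ,
  limit-of-PS/n 6 36 λ n 36≤n → let G , _ , depth = deep-graphs n 36≤n in PS-bound {6} G depth
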